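{- Let $G$ be a finite simple circular-arc graph with maximum degree $\Delta$. Then $\mathrm{cub}(G)\le 2\Delta+1$, where $\mathrm{cub}(G)$ denotes the cubicity of $G$.
   Context: All graphs are simple, finite and undirected. Cubicity: a $k$-cube is a Cartesian product $R_1\times\cdots\times R_k$ where each $R_i$ is a closed interval of the form $[a_i,a_i+1]$ on the real line. The cubicity $\mathrm{cub}(G)$ is the minimum $k$ such that each vertex of $G$ can be mapped to a $k$-cube so that two distinct vertices are adjacent in $G$ if and only if their $k$-cubes have non-empty intersection. A circular-arc graph is the intersection graph of a family of arcs on a circle: each vertex can be assigned a closed arc of the circle so that two distinct vertices are adjacent if and only if their arcs intersect. -}

module Defs where

open import Data.Fin using (Fin)
open import Data.List using (length; filter; map; allFin)
open import Data.List.Extrema.Nat using (max)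
open import Data.Nat using (ℕ; _≤_)
open import Data.Product using (∃-syntax; Σ-syntax; _×_; _,_)
open import Data.Rational using (ℚ; 1ℚ; _<_; _+_; _-_; -_; _/_)
import Data.Rational.Properties as ℚ
open import Data.Sum using (_⊎_)
open import Function using (_⇔_; mk⇔)
open import Function.Bundles using (Equivalence)
open import Level using (0ℓ; _⊔_)
open import Relation.Binary using (Rel; Decidable; Symmetric; Irreflexive)
open import Relation.Binary.PropositionalEquality
open import Relation.Unary using (Pred; _∈_; _∉_; _⊆_; _∩_; _≬_; Satisfiable)

-- Real numbers as two-sided Dedekind cuts of ℚ.  Classically this is the usual
-- real line; locatedness makes it the usual constructive one as well.

record ℝ : Set₁ where
  field
    L U         : Pred ℚ 0ℓ
    L-inhabited : Satisfiable L
    U-inhabited : Satisfiable U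
    L-rounded   : ∀ q → q ∈ L ⇔ (∃[ r ] q < r × r ∈ L)
    U-rounded   : ∀ r → r ∈ U ⇔ (∃[ q ] q < r × q ∈ U)
    disjoint    : ∀ q → q ∉ L ∩ U
    located     : ∀ q r → q < r → q ∈ L ⊎ r ∈ U

open ℝ

infix 4 _≤ᴿ_
infixl 6 _⊕_

_≤ᴿ_ : Rel ℝ 0ℓ
x ≤ᴿ y = L x ⊆ L y

private
  +-cancel : ∀ p q → (p + q) - q ≡ p
  +-cancel p q = trans (ℚ.+-assoc p q (- q))
                (trans (cong (p +_) (ℚ.+-inverseʳ q)) (ℚ.+-identityʳ p))

  -‿cancel : ∀ p q → (p - q) + q ≡ p
  -‿cancel p q = trans (ℚ.+-assoc p (- q) q)
                (trans (cong (p +_) (ℚ.+-inverseˡ q)) (ℚ.+-identityʳ p))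

  shift< : ∀ {p r} q → p < r → p - q < r - q
  shift< q = ℚ.+-monoˡ-< (- q)

  unshift<ˡ : ∀ {p r} q → p - q < r → p < r + q
  unshift<ˡ {p} {r} q lt = subst (_< r + q) (-‿cancel p q) (ℚ.+-monoˡ-< q lt)

  unshift<ʳ : ∀ {p r} q → p < r - q → p + q < r
  unshift<ʳ {p} {r} q lt = subst (p + q <_) (-‿cancel r q) (ℚ.+-monoˡ-< q lt)

-- Only translations of the real line by rationals are needed.

_⊕_ : ℝ → ℚ → ℝ
(x ⊕ c) .L p = p - c ∈ L x
(x ⊕ c) .U p = p - c ∈ U x
(x ⊕ c) .L-inhabited with q , q∈L ← L-inhabited x =
  q + c , subst (_∈ L x) (sym (+-cancel q c)) q∈L
(x ⊕ c) .U-inhabited with q , q∈U ← U-inhabited x =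
  q + c , subst (_∈ U x) (sym (+-cancel q c)) q∈U
(x ⊕ c) .L-rounded q = mk⇔
  (λ h → let r , lt , r∈L = Equivalence.to (L-rounded x (q - c)) h in
         r + c , unshift<ˡ c lt , subst (_∈ L x) (sym (+-cancel r c)) r∈L)
  (λ (r , lt , r∈L) → Equivalence.from (L-rounded x (q - c)) (r - c , shift< c lt , r∈L))
(x ⊕ c) .U-rounded r = mk⇔
  (λ h → let q , lt , q∈U = Equivalence.to (U-rounded x (r - c)) h in
         q + c , unshift<ʳ c lt , subst (_∈ U x) (sym (+-cancel q c)) q∈U)
  (λ (q , lt , q∈U) → Equivalence.from (U-rounded x (r - c)) (q - c , shift< c lt , q∈U))
(x ⊕ c) .disjoint q = disjoint x (q - c)
(x ⊕ c) .located q r lt = located x (q - c) (r - c) (shift< c lt)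

Interval : ℝ → ℝ → Pred ℝ 0ℓ
Interval a b x = a ≤ᴿ x × x ≤ᴿ b

record Graph (n : ℕ) : Set₁ where
  field
    Adj         : Rel (Fin n) 0ℓ
    adj?        : Decidable Adj
    symmetric   : Symmetric Adj
    irreflexive : Irreflexive _≡_ Adj

open Graph public using (Adj; adj?)

degree : ∀ {n} → Graph n → Fin n → ℕ
degree {n} G v = length (filter (adj? G v) (allFin n))

-- The graph without vertices is given maximum degree 0.

maxDegree : ∀ {n} → Graph n → ℕ
maxDegree {n} G = max 0 (map (degree G) (allFin n))

IsIntersectionGraph : ∀ {n a ℓ} {A : Set a} → Graph n → (Fin n → Pred A ℓ) → Set (a ⊔ ℓ)
IsIntersectionGraph G S = ∀ u v → u ≢ v → Adj G u v ⇔ (S u ≬ S v)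

-- The k-cube ∏ᵢ [aᵢ, aᵢ + 1]; for k = 0 it is a single point.

Cube : ∀ {k} → (Fin k → ℝ) → Pred (Fin k → ℝ) 0ℓ
Cube a x = ∀ i → x i ∈ Interval (a i) (a i ⊕ 1ℚ)

HasCubeRepresentation : ∀ {n} → Graph n → ℕ → Set₁
HasCubeRepresentation {n} G k =
  Σ[ a ∈ (Fin n → Fin k → ℝ) ] IsIntersectionGraph G (λ v → Cube (a v))

IsCubicity : ∀ {n} → Graph n → ℕ → Set₁
IsCubicity G c = HasCubeRepresentation G c ×
                 (∀ k → HasCubeRepresentation G k → c ≤ k)

-- The circle is ℝ/ℤ, its points being named by real representatives.  A closed
-- arc is the image of an interval [start, end] of length at most 1; length 1
-- gives the whole circle and length 0 a single point.

record Arc : Set₁ where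
  field
    start end   : ℝ
    start≤end   : start ≤ᴿ end
    end≤start+1 : end ≤ᴿ start ⊕ 1ℚ

⟦_⟧ : Arc → Pred ℝ 0ℓ
⟦ α ⟧ x = ∃[ m ] x ⊕ (m / 1) ∈ Interval (Arc.start α) (Arc.end α)

IsCircularArc : ∀ {n} → Graph n → Set₁
IsCircularArc {n} G = Σ[ arc ∈ (Fin n → Arc) ] IsIntersectionGraph G (λ v → ⟦ arc v ⟧)

{-# OPTIONS --safe #-}

-- A cube representation in dimension k is a way of writing G as an intersection of
-- k indifference graphs.  A semiorder is the combinatorial content of such a graph,
-- so having k of them is a decidable property of the finite graph G; it is
-- equivalent to having a cube representation, because a semiorder sorted by its
-- traces can be realised greedily by rational points.  This gives the existence of
-- the cubicity, and it allows the bound to be proved under a double negation, with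
-- all comparisons of real numbers decided.
--
-- For the bound, number the vertices of a circular-arc graph by the starting points
-- of their arcs.  The vertices whose starting points lie in a given arc follow it
-- consecutively in the cyclic order and are its neighbours, so adjacent vertices
-- are at cyclic distance at most Δ.  Folding the circle gives a linear numbering of
-- bandwidth b = 2Δ.  A graph of bandwidth b is the intersection of b + 1 indifference
-- graphs: one separates the non-adjacent pairs at distance b or more, and one for
-- each residue class modulo b separates the vertices of the class from their
-- non-neighbours among the next b - 1 vertices.

module Submission where

open import Defs
open import Data.Bool using (Bool; true; false; T)
open import Data.Empty using (⊥; ⊥-elim)
open import Data.Fin using (Fin; zero; suc; toℕ) renaming (_≤_ to _Fin≤_)
import Data.Fin.Properties as Fin
open import Data.Integer as ℤ using (ℤ; +_; -[1+_]; 0ℤ; 1ℤ; ∣_∣)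
import Data.Integer.Properties as ℤ
open import Data.Integer.Tactic.RingSolver using (solve-∀)
open import Data.List using (List; []; _∷_; _++_; length; map; filter; allFin)
open import Data.List.Extrema.Nat using (max; xs≤max)
open import Data.List.Membership.Propositional using (_∈_)
open import Data.List.Membership.Propositional.Properties
  using (∈-allFin; ∈-map⁺; ∈-map⁻; ∈-++⁺ˡ; ∈-++⁺ʳ; ∈-++⁻; ∈-filter⁺; ∈-filter⁻; ∈-length)
open import Data.List.Properties using (length-filter; length-tabulate; filter-all)
open import Data.List.Relation.Binary.Permutation.Propositional using (↭-sym; ↭⇒↭ₛ)
open import Data.List.Relation.Binary.Permutation.Propositional.Properties using (∈-resp-↭)
import Data.List.Relation.Binary.Permutation.Setoid.Properties as Permutation
open import Data.List.Relation.Unary.All as All using (All; []; _∷_)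
open import Data.List.Relation.Unary.AllPairs as AllPairs using (AllPairs; []; _∷_)
open import Data.List.Relation.Unary.Any using (here; there)
import Data.List.Relation.Unary.Linked.Properties as Linked
import Data.List.Relation.Unary.Unique.Propositional.Properties as Unique
import Data.List.Sort
open import Data.Nat as ℕ using (ℕ; zero; suc; NonZero; _+_; _*_; _∸_; _≤_; _<_; _/_; _%_)
import Data.Nat.Coprimality as Coprime
open import Data.Nat.DivMod
open import Data.Nat.Induction using (<-wellFounded)
import Data.Nat.Properties as ℕ
open import Data.Product using (_×_; _,_; proj₁; proj₂; ∃; ∃-syntax; Σ-syntax; swap)
open import Data.Rational as ℚ using (ℚ; 0ℚ; 1ℚ; mkℚ; *<*)
import Data.Rational.Properties as ℚ
open import Data.Rational.Solver using (module +-*-Solver)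
open import Data.Sum as Sum using (_⊎_; inj₁; inj₂)
open import Data.Unit using (⊤; tt)
open import Data.Vec using (Vec; []; _∷_; lookup; tabulate)
open import Data.Vec.Properties using (lookup∘tabulate)
open import Effect.Monad using (RawMonad)
open import Function using (_⇔_; mk⇔; _∘_; id)
open import Function.Bundles using (Equivalence)
open import Function.Definitions using (Injective)
open import Induction.WellFounded using (Acc; acc)
open import Level using (0ℓ)
open import Relation.Binary
  using (Rel; Decidable; DecTotalOrder; IsDecTotalOrder; tri<; tri≈; tri>)
open import Relation.Binary.PropositionalEquality
open import Relation.Nullary using (¬_; Dec; yes; no)
open import Relation.Nullary.Decidable
  using (map′; _×-dec_; _⊎-dec_; _→-dec_; ¬?; T?; isYes; decidable-stable; ¬¬-excluded-middle)
open import Relation.Nullary.Negation using (¬¬-Monad)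
import Relation.Unary as U
import Algebra.Properties.Group ℚ.+-0-group as ℚ-group
import Data.List.Extrema (DecTotalOrder.totalOrder ℚ.≤-decTotalOrder) as ℚ-Extrema

open Equivalence using (to; from)
open ℝ

private
  variable
    k m n : ℕ

-- Semiorders

-- Double negation commutes with finite conjunctions, so in a negative goal all the finitely many
-- comparisons of reals may be assumed decided at once.
¬¬-∀ : ∀ {p} {P : Fin n → Set p} → (∀ i → ¬ ¬ P i) → ¬ ¬ (∀ i → P i)
¬¬-∀ = Fin.sequence (RawMonad.rawApplicative ¬¬-Monad)

Searchable : Set → Set₁
Searchable A = ∀ {P : A → Set} → U.Decidable P → Dec (∃ P)

bool-searchable : Searchable Bool
bool-searchable P? = map′
  (λ { (inj₁ p) → true , p ; (inj₂ p) → false , p })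
  (λ { (true , p) → inj₁ p ; (false , p) → inj₂ p })
  (P? true ⊎-dec P? false)

vec-searchable : ∀ {A} → Searchable A → Searchable (Vec A m)
vec-searchable {zero} search P? =
  map′ (λ p → [] , p) (λ { ([] , p) → p }) (P? [])
vec-searchable {suc m} search P? = map′
  (λ (x , xs , p) → x ∷ xs , p)
  (λ { (x ∷ xs , p) → x , xs , p })
  (search (λ x → vec-searchable search (λ xs → P? (x ∷ xs))))

-- A semiorder is encoded by the relation  B u v = "v is not to the right of the
-- unit interval starting at u", that is a_v ≤ a_u + 1.  Trace u v is then forced
-- by a_u ≤ a_v.
Trace : Rel (Fin n) 0ℓ → Rel (Fin n) 0ℓ
Trace B u v = ∀ w → (B u w → B v w) × (B w v → B w u)

IsSemiorder : Rel (Fin n) 0ℓ → Set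
IsSemiorder B = (∀ u → B u u) × (∀ u v → Trace B u v ⊎ Trace B v u)

Represents : Graph n → (Fin k → Rel (Fin n) 0ℓ) → Set
Represents G B = (∀ i → IsSemiorder (B i)) ×
  (∀ u v → u ≢ v → Adj G u v ⇔ (∀ i → B i u v × B i v u))

HasSemiorders : Graph n → ℕ → Set₁
HasSemiorders {n} G k =
  Σ[ B ∈ (Fin k → Rel (Fin n) 0ℓ) ] (∀ i → Decidable (B i)) × Represents G B

trace? : {B : Rel (Fin n) 0ℓ} → Decidable B → Decidable (Trace B)
trace? B? u v = Fin.all? λ w → (B? u w →-dec B? v w) ×-dec (B? w v →-dec B? w u)

isSemiorder? : {B : Rel (Fin n) 0ℓ} → Decidable B → Dec (IsSemiorder B)
isSemiorder? B? = Fin.all? (λ u → B? u u) ×-dec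
  Fin.all? (λ u → Fin.all? λ v → trace? B? u v ⊎-dec trace? B? v u)

represents? : (G : Graph n) {B : Fin k → Rel (Fin n) 0ℓ} →
              (∀ i → Decidable (B i)) → Dec (Represents G B)
represents? G {B} B? = Fin.all? (λ i → isSemiorder? (B? i)) ×-dec
  Fin.all? λ u → Fin.all? λ v → ¬? (u Fin.≟ v) →-dec
    map′ (λ (f , g) → mk⇔ f g) (λ e → to e , from e)
      ((adj? G u v →-dec near? u v) ×-dec (near? u v →-dec adj? G u v))
  where
  near? : Decidable (λ u v → ∀ i → B i u v × B i v u)
  near? u v = Fin.all? λ i → B? i u v ×-dec B? i v u

represents-resp : (G : Graph n) {B C : Fin k → Rel (Fin n) 0ℓ} →
  (∀ i u v → B i u v ⇔ C i u v) → Represents G B → Represents G C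
represents-resp G {B} {C} B⇔C (semi , adj) = semi′ , adj′
  where
  trace′ : ∀ i {u v} → Trace (B i) u v → Trace (C i) u v
  trace′ i tr w =
    to (B⇔C i _ _) ∘ proj₁ (tr w) ∘ from (B⇔C i _ _) ,
    to (B⇔C i _ _) ∘ proj₂ (tr w) ∘ from (B⇔C i _ _)
  semi′ : ∀ i → IsSemiorder (C i)
  semi′ i = (λ u → to (B⇔C i u u) (proj₁ (semi i) u)) ,
            (λ u v → Sum.map (trace′ i) (trace′ i) (proj₂ (semi i) u v))
  adj′ : ∀ u v → u ≢ v → Adj G u v ⇔ (∀ i → C i u v × C i v u)
  adj′ u v u≢v = mk⇔
    (λ a i → let p , q = to (adj u v u≢v) a i in to (B⇔C i u v) p , to (B⇔C i v u) q)
    (λ h → from (adj u v u≢v) λ i → let p , q = h i in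
           from (B⇔C i u v) p , from (B⇔C i v u) q)

-- Boolean matrices can be enumerated, relations valued in `Set` cannot. Vectors are used because a
-- predicate on functions need not respect pointwise equality.
Matrix : ℕ → Set
Matrix n = Vec (Vec Bool n) n

⟨_⟩ : Matrix n → Rel (Fin n) 0ℓ
⟨ M ⟩ u v = T (lookup (lookup M u) v)

⟨_⟩? : (M : Matrix n) → Decidable ⟨ M ⟩
⟨ M ⟩? u v = T? _

toMatrix : {B : Rel (Fin n) 0ℓ} → Decidable B → Matrix n
toMatrix B? = tabulate λ u → tabulate λ v → isYes (B? u v)

toMatrix-⇔ : {B : Rel (Fin n) 0ℓ} (B? : Decidable B) → ∀ u v → B u v ⇔ ⟨ toMatrix B? ⟩ u v
toMatrix-⇔ B? u v
  rewrite lookup∘tabulate (λ u → tabulate λ v → isYes (B? u v)) u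
        | lookup∘tabulate (λ v → isYes (B? u v)) v
  with B? u v
... | yes b = mk⇔ _ (λ _ → b)
... | no ¬b = mk⇔ ¬b (λ ())

hasSemiorders? : (G : Graph n) (k : ℕ) → Dec (HasSemiorders G k)
hasSemiorders? {n} G k = map′
  (λ (Ms , rep) → (λ i → ⟨ lookup Ms i ⟩) , (λ i → ⟨ lookup Ms i ⟩?) , rep)
  (λ (B , B? , rep) → tabulate (λ i → toMatrix (B? i)) ,
    represents-resp G (λ i u v → subst (λ M → B i u v ⇔ ⟨ M ⟩ u v)
      (sym (lookup∘tabulate (λ i → toMatrix (B? i)) i)) (toMatrix-⇔ (B? i) u v)) rep)
  (vec-searchable (vec-searchable (vec-searchable bool-searchable)) {P = P}
    (λ Ms → represents? G (λ i → ⟨ lookup Ms i ⟩?)))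
  where
  P : Vec (Matrix n) k → Set
  P Ms = Represents G (λ i → ⟨ lookup Ms i ⟩)

-- Cube representations and semiorders

p-1<p : ∀ p → p ℚ.- 1ℚ ℚ.< p
p-1<p p = subst (p ℚ.- 1ℚ ℚ.<_) (ℚ.+-identityʳ p) (ℚ.+-monoʳ-< p (ℚ.negative⁻¹ (ℚ.- 1ℚ)))

p<p+1 : ∀ p → p ℚ.< p ℚ.+ 1ℚ
p<p+1 p = subst (ℚ._< p ℚ.+ 1ℚ) (ℚ.+-identityʳ p) (ℚ.+-monoʳ-< p (ℚ.positive⁻¹ 1ℚ))

L-downward : ∀ x {p q} → p ℚ.< q → q U.∈ L x → p U.∈ L x
L-downward x p<q q∈L = from (L-rounded x _) (_ , p<q , q∈L)

L<U : ∀ x {p q} → p U.∈ L x → q U.∈ U x → p ℚ.< q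
L<U x {p} {q} p∈L q∈U with ℚ.<-cmp p q
... | tri< p<q _ _ = p<q
... | tri≈ _ refl _ = ⊥-elim (disjoint x p (p∈L , q∈U))
... | tri> _ _ q<p = ⊥-elim (disjoint x q (L-downward x q<p p∈L , q∈U))

-- Locate `x` against `p < q`, both in `L y`. If `q` were above `x`, all of `L x` would lie below
-- `q`, giving `x ≤ᴿ y`.
≰ᴿ⇒≥ᴿ : ∀ x y → ¬ (x ≤ᴿ y) → y ≤ᴿ x
≰ᴿ⇒≥ᴿ x y x≰y {p} p∈Ly with to (L-rounded y p) p∈Ly
... | q , p<q , q∈Ly with located x p q p<q
...   | inj₁ p∈Lx = p∈Lx
...   | inj₂ q∈Ux = ⊥-elim (x≰y λ r∈Lx → L-downward y (L<U x r∈Lx q∈Ux) q∈Ly)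

≤ᴿ-total : ∀ x y → Dec (x ≤ᴿ y) → x ≤ᴿ y ⊎ y ≤ᴿ x
≤ᴿ-total x y (yes x≤y) = inj₁ x≤y
≤ᴿ-total x y (no x≰y) = inj₂ (≰ᴿ⇒≥ᴿ x y x≰y)

x≤x⊕1 : ∀ x → x ≤ᴿ x ⊕ 1ℚ
x≤x⊕1 x {p} = L-downward x (p-1<p p)

-- In each coordinate the larger of the two left endpoints is a common point.
cubes-meet : (a b : Fin k → ℝ) → (∀ i → a i ≤ᴿ b i ⊎ b i ≤ᴿ a i) →
  (Cube a U.≬ Cube b) ⇔ (∀ i → b i ≤ᴿ a i ⊕ 1ℚ × a i ≤ᴿ b i ⊕ 1ℚ)
cubes-meet {k} a b total = mk⇔
  (λ (x , xa , xb) i → proj₂ (xa i) ∘ proj₁ (xb i) , proj₂ (xb i) ∘ proj₁ (xa i))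
  (λ h → (λ i → proj₁ (point h i)) , (λ i → proj₁ (proj₂ (point h i))) ,
                                     (λ i → proj₂ (proj₂ (point h i))))
  where
  point : (∀ i → b i ≤ᴿ a i ⊕ 1ℚ × a i ≤ᴿ b i ⊕ 1ℚ) → (i : Fin k) →
    ∃[ x ] x U.∈ Interval (a i) (a i ⊕ 1ℚ) × x U.∈ Interval (b i) (b i ⊕ 1ℚ)
  point h i with total i
  ... | inj₁ a≤b = b i , (a≤b , proj₁ (h i)) , (id , x≤x⊕1 (b i))
  ... | inj₂ b≤a = a i , (id , x≤x⊕1 (a i)) , (b≤a , proj₂ (h i))

-- Traces follow the order of the left endpoints. Excluded middle supplies both the comparability of
-- endpoints and the decisions of `B`.
cubes⇒¬¬semiorders : (G : Graph n) → HasCubeRepresentation G k → ¬ ¬ HasSemiorders G k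
cubes⇒¬¬semiorders {n} {k} G (a , rep) none =
  ¬¬-∀ (λ i → ¬¬-∀ λ u → ¬¬-∀ λ v → ¬¬-excluded-middle {A = a u i ≤ᴿ a v i}) λ ≤? →
  ¬¬-∀ (λ i → ¬¬-∀ λ u → ¬¬-∀ λ v → ¬¬-excluded-middle {A = a v i ≤ᴿ a u i ⊕ 1ℚ}) λ B? →
  none (B , B? ,
    (λ i → (λ u → x≤x⊕1 (a u i)) ,
           (λ u v → Sum.map (trace i u v) (trace i v u) (≤ᴿ-total (a u i) (a v i) (≤? i u v)))) ,
    (λ u v u≢v → let e = cubes-meet (a u) (a v) (λ i → ≤ᴿ-total (a u i) (a v i) (≤? i u v))
                 in mk⇔ (to e ∘ to (rep u v u≢v)) (from (rep u v u≢v) ∘ from e)))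
  where
  B : Fin k → Rel (Fin n) 0ℓ
  B i u v = a v i ≤ᴿ a u i ⊕ 1ℚ
  trace : ∀ i u v → a u i ≤ᴿ a v i → Trace (B i) u v
  trace i u v u≤v w = (λ w≤u+1 {p} p∈L → u≤v (w≤u+1 {p} p∈L)) ,
                      (λ v≤w+1 {p} p∈L → v≤w+1 {p} (u≤v p∈L))

-- Rational points realising a semiorder.

rational : ℚ → ℝ
rational q .L p = p ℚ.< q
rational q .U p = q ℚ.< p
rational q .L-inhabited = q ℚ.- 1ℚ , p-1<p q
rational q .U-inhabited = q ℚ.+ 1ℚ , p<p+1 q
rational q .L-rounded p = mk⇔
  (λ p<q → let m , p<m , m<q = ℚ.<-dense p<q in m , p<m , m<q)
  (λ (r , p<r , r<q) → ℚ.<-trans p<r r<q)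
rational q .U-rounded p = mk⇔
  (λ q<p → let m , q<m , m<p = ℚ.<-dense q<p in m , m<p , q<m)
  (λ (r , r<p , q<r) → ℚ.<-trans q<r r<p)
rational q .disjoint p (p<q , q<p) = ℚ.<-asym p<q q<p
rational q .located p r p<r with ℚ._<?_ p q
... | yes p<q = inj₁ p<q
... | no p≮q = inj₂ (ℚ.≤-<-trans (ℚ.≮⇒≥ p≮q) p<r)

rational-mono : ∀ {p q} → p ℚ.≤ q → rational p ≤ᴿ rational q
rational-mono p≤q r<p = ℚ.<-≤-trans r<p p≤q

private
  sub-add : ∀ p c → p ℚ.- c ℚ.+ c ≡ p
  sub-add = +-*-Solver.solve 2 (λ p c → p :- c :+ c := p) refl
    where open +-*-Solver
  add-sub : ∀ p c → p ℚ.+ c ℚ.- c ≡ p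
  add-sub = +-*-Solver.solve 2 (λ p c → p :+ c :- c := p) refl
    where open +-*-Solver

<+⇒-< : ∀ {p q} c → p ℚ.< q ℚ.+ c → p ℚ.- c ℚ.< q
<+⇒-< {p} {q} c p<q+c = subst (p ℚ.- c ℚ.<_) (add-sub q c) (ℚ.+-monoˡ-< (ℚ.- c) p<q+c)

-<⇒<+ : ∀ {p q} c → p ℚ.- c ℚ.< q → p ℚ.< q ℚ.+ c
-<⇒<+ {p} {q} c p-c<q = subst (ℚ._< q ℚ.+ c) (sub-add p c) (ℚ.+-monoˡ-< c p-c<q)

<-⇒+< : ∀ {p q} c → p ℚ.< q ℚ.- c → p ℚ.+ c ℚ.< q
<-⇒+< {p} {q} c p<q-c = subst (p ℚ.+ c ℚ.<_) (sub-add q c) (ℚ.+-monoˡ-< c p<q-c)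

rational-≤⊕ : ∀ {p q} c → rational p ≤ᴿ rational q ⊕ c ⇔ p ℚ.≤ q ℚ.+ c
rational-≤⊕ {p} {q} c = mk⇔
  (λ h → ℚ.≮⇒≥ λ q+c<p → ℚ.<-irrefl (add-sub q c) (h q+c<p))
  (λ p≤q+c {r} r<p → <+⇒-< c (ℚ.<-≤-trans r<p p≤q+c))

between : (ls us : List ℚ) → (∀ {l u} → l ∈ ls → u ∈ us → l ℚ.< u) →
          ∃[ q ] (∀ {l} → l ∈ ls → l ℚ.< q) × (∀ {u} → u ∈ us → q ℚ.< u)
between ls us l<u =
  let q , lo<q , q<hi = ℚ.<-dense lo<hi in
  q , (λ l∈ → ℚ.≤-<-trans (All.lookup (ℚ-Extrema.xs≤max start ls) l∈) lo<q) ,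
      (λ u∈ → ℚ.<-≤-trans q<hi (All.lookup (ℚ-Extrema.min≤xs end us) u∈))
  where
  start lo end hi : ℚ
  -- Defaults for empty lists: `start` lies below all of `us`, and `end` lies above `lo`.
  start = ℚ-Extrema.min ℚ.0ℚ us ℚ.- 1ℚ
  lo = ℚ-Extrema.max start ls
  end = lo ℚ.+ 1ℚ
  hi = ℚ-Extrema.min end us
  lo<us : ∀ {u} → u ∈ us → lo ℚ.< u
  lo<us {u} u∈ with ℚ-Extrema.argmax-sel id start ls
  ... | inj₁ lo≡ = subst (ℚ._< u) (sym lo≡)
    (ℚ.<-≤-trans (p-1<p _) (All.lookup (ℚ-Extrema.min≤xs ℚ.0ℚ us) u∈))
  ... | inj₂ lo∈ = l<u lo∈ u∈
  lo<hi : lo ℚ.< hi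
  lo<hi with ℚ-Extrema.argmin-sel id end us
  ... | inj₁ hi≡ = subst (lo ℚ.<_) (sym hi≡) (p<p+1 lo)
  ... | inj₂ hi∈ = lo<us hi∈

-- Here `u` is to the left of `v`. All inequalities are strict, so a new point has to fit only into
-- an open interval. `B v u` follows from reflexivity along the trace order.
Placed : Rel (Fin n) 0ℓ → (Fin n → ℚ) → Rel (Fin n) 0ℓ
Placed B f u v = f u ℚ.< f v × (B u v → f v ℚ.< f u ℚ.+ 1ℚ) × (¬ B u v → f u ℚ.+ 1ℚ ℚ.< f v)

related : ∀ {A : Set} {R : Rel A 0ℓ} {xs : List A} → AllPairs R xs →
          ∀ {x y} → x ∈ xs → y ∈ xs → x ≢ y → R x y ⊎ R y x
related (Rx ∷ Rxs) (here refl) (here refl) x≢y = ⊥-elim (x≢y refl)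
related (Rx ∷ Rxs) (here refl) (there y∈) x≢y = inj₁ (All.lookup Rx y∈)
related (Rx ∷ Rxs) (there x∈) (here refl) x≢y = inj₂ (All.lookup Rx x∈)
related (Rx ∷ Rxs) (there x∈) (there y∈) x≢y = related Rxs x∈ y∈ x≢y

map-AllPairs : ∀ {A : Set} {R S : Rel A 0ℓ} {xs : List A} →
  (∀ {x y} → x ∈ xs → y ∈ xs → R x y → S x y) → AllPairs R xs → AllPairs S xs
map-AllPairs R⇒S [] = []
map-AllPairs R⇒S (Rx ∷ Rxs) =
  All.tabulate (λ y∈ → R⇒S (here refl) (there y∈) (All.lookup Rx y∈)) ∷
  map-AllPairs (λ x∈ y∈ → R⇒S (there x∈) (there y∈)) Rxs

-- The elements are placed from right to left.  The new leftmost point x has to lie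
-- above f v - 1 for its neighbours v, below f v - 1 for the other v, and below all
-- points placed so far.
place : {B : Rel (Fin n) 0ℓ} → Decidable B → (∀ u → B u u) → ∀ {xs} →
  AllPairs (λ u v → Trace B u v × u ≢ v) xs → ∃[ f ] AllPairs (Placed B f) xs
place B? B-refl {[]} [] = (λ _ → 1ℚ) , []
place {n} {B} B? B-refl {x ∷ xs} (x≤xs ∷ sorted) with place B? B-refl sorted
... | f , placed = f′ , All.tabulate placed-x ∷ placed-xs
  where
  ordered : ∀ {v w} → v ∈ xs → w ∈ xs → v ≢ w →
            (Trace B v w × Placed B f v w) ⊎ (Trace B w v × Placed B f w v)
  ordered v∈ w∈ v≢w = related (AllPairs.zip (AllPairs.map proj₁ sorted , placed)) v∈ w∈ v≢w
  near far : List (Fin n)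
  near = filter (B? x) xs
  far = filter (¬? ∘ B? x) xs
  f-1 : Fin n → ℚ
  f-1 v = f v ℚ.- 1ℚ
  apart : ∀ {l u} → l ∈ map f-1 near → u ∈ map f xs ++ map f-1 far → l ℚ.< u
  apart l∈ u∈ with ∈-map⁻ f-1 l∈
  ... | v , v∈near , refl with ∈-filter⁻ (B? x) {xs = xs} v∈near | ∈-++⁻ (map f xs) u∈
  ...   | v∈ , Bxv | inj₁ w∈ with ∈-map⁻ f w∈
  ...     | w , w∈ , refl with v Fin.≟ w
  ...       | yes refl = p-1<p (f v)
  ...       | no v≢w with ordered v∈ w∈ v≢w
  ...         | inj₁ (_ , v<w , _) = ℚ.<-trans (p-1<p (f v)) v<w
  -- `x` precedes `w` in the trace order, so `B x v` gives `B w v`.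
  ...         | inj₂ (_ , _ , near-wv , _) =
    <+⇒-< 1ℚ (near-wv (proj₁ (proj₁ (All.lookup x≤xs w∈) v) Bxv))
  apart l∈ u∈ | v , v∈near , refl | v∈ , Bxv | inj₂ w∈ with ∈-map⁻ f-1 w∈
  ... | w , w∈far , refl with ∈-filter⁻ (¬? ∘ B? x) {xs = xs} w∈far
  ...   | w∈ , ¬Bxw with ordered v∈ w∈ (λ { refl → ¬Bxw Bxv })
  ...     | inj₁ (_ , v<w , _) = ℚ.+-monoˡ-< (ℚ.- 1ℚ) v<w
  -- If `w` preceded `v`, then `B x v` would imply `B x w`.
  ...     | inj₂ (w≤v , _) = ⊥-elim (¬Bxw (proj₂ (w≤v x) Bxv))
  position : ∃[ q ] (∀ {l} → l ∈ map f-1 near → l ℚ.< q) ×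
                    (∀ {u} → u ∈ map f xs ++ map f-1 far → q ℚ.< u)
  position = between (map f-1 near) (map f xs ++ map f-1 far) apart
  q : ℚ
  q = proj₁ position
  f′ : Fin n → ℚ
  f′ v with v Fin.≟ x
  ... | yes _ = q
  ... | no _ = f v
  f′-x : f′ x ≡ q
  f′-x with x Fin.≟ x
  ... | yes _ = refl
  ... | no x≢x = ⊥-elim (x≢x refl)
  f′-xs : ∀ {v} → v ∈ xs → f′ v ≡ f v
  f′-xs {v} v∈ with v Fin.≟ x
  ... | yes refl = ⊥-elim (proj₂ (All.lookup x≤xs v∈) refl)
  ... | no _ = refl
  placed-x : ∀ {v} → v ∈ xs → Placed B f′ x v
  placed-x {v} v∈ rewrite f′-x | f′-xs v∈ =
    proj₂ (proj₂ position) (∈-++⁺ˡ (∈-map⁺ f v∈)) ,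
    (λ Bxv → -<⇒<+ 1ℚ (proj₁ (proj₂ position) (∈-map⁺ f-1 (∈-filter⁺ (B? x) v∈ Bxv)))) ,
    (λ ¬Bxv → <-⇒+< 1ℚ (proj₂ (proj₂ position) (∈-++⁺ʳ (map f xs)
      (∈-map⁺ f-1 (∈-filter⁺ (¬? ∘ B? x) v∈ ¬Bxv)))))
  placed-xs : AllPairs (Placed B f′) xs
  placed-xs = map-AllPairs
    (λ {u} {v} u∈ v∈ p → subst₂
      (λ a b → a ℚ.< b × (B u v → b ℚ.< a ℚ.+ 1ℚ) × (¬ B u v → a ℚ.+ 1ℚ ℚ.< b))
      (sym (f′-xs u∈)) (sym (f′-xs v∈)) p)
    placed

module _ {B : Rel (Fin n) 0ℓ} (B? : Decidable B) (semiorder : IsSemiorder B) where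

  traceOrder : DecTotalOrder 0ℓ 0ℓ 0ℓ
  traceOrder = record
    { Carrier = Fin n
    ; _≈_ = λ u v → Trace B u v × Trace B v u
    ; _≤_ = Trace B
    ; isDecTotalOrder = record
      { isTotalOrder = record
        { isPartialOrder = record
          { isPreorder = record
            { isEquivalence = record
              { refl = (λ _ → id , id) , (λ _ → id , id)
              ; sym = swap
              ; trans = λ (p , p′) (q , q′) → trace-trans p q , trace-trans q′ p′
              }
            ; reflexive = proj₁
            ; trans = trace-trans
            }
          ; antisym = _,_
          }
        ; total = proj₂ semiorder
        }
      ; _≟_ = λ u v → trace? B? u v ×-dec trace? B? v u
      ; _≤?_ = trace? B?
      }
    }
    where
    trace-trans : ∀ {u v w} → Trace B u v → Trace B v w → Trace B u w
    trace-trans p q x = proj₁ (q x) ∘ proj₁ (p x) , proj₂ (p x) ∘ proj₂ (q x)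

  open Data.List.Sort traceOrder using (sort; sort-↭; sort-↗)

  sorted : AllPairs (λ u v → Trace B u v × u ≢ v) (sort (allFin n))
  sorted = AllPairs.zip
    ( Linked.Linked⇒AllPairs (DecTotalOrder.trans traceOrder) (sort-↗ (allFin n))
    , Permutation.Unique-resp-↭ (setoid (Fin n))
        (↭⇒↭ₛ (↭-sym (sort-↭ (allFin n)))) (Unique.allFin⁺ n) )

  semiorder⇒rational : ∃[ f ] (∀ u v → u ≢ v → B u v ⇔ f v ℚ.≤ f u ℚ.+ 1ℚ)
  semiorder⇒rational = f , correct
    where
    f : Fin n → ℚ
    f = proj₁ (place B? (proj₁ semiorder) sorted)
    both : AllPairs (λ u v → Trace B u v × Placed B f u v) (sort (allFin n))
    both = AllPairs.zip (AllPairs.map proj₁ sorted , proj₂ (place B? (proj₁ semiorder) sorted))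
    member : ∀ v → v ∈ sort (allFin n)
    member v = ∈-resp-↭ (↭-sym (sort-↭ (allFin n))) (∈-allFin v)
    correct : ∀ u v → u ≢ v → B u v ⇔ f v ℚ.≤ f u ℚ.+ 1ℚ
    correct u v u≢v with related both (member u) (member v) u≢v
    ... | inj₁ (_ , _ , near , far) = mk⇔ (ℚ.<⇒≤ ∘ near)
      (λ fv≤fu+1 → decidable-stable (B? u v) λ ¬Buv →
        ℚ.<-irrefl refl (ℚ.<-≤-trans (far ¬Buv) fv≤fu+1))
    -- With `v` on the left both sides hold: `B u v` comes from `B v v` along the trace order.
    ... | inj₂ (v≤u , fv<fu , _) = mk⇔
      (λ _ → ℚ.<⇒≤ (ℚ.<-trans fv<fu (p<p+1 (f u))))
      (λ _ → proj₁ (v≤u v) (proj₁ semiorder v))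

semiorders⇒cubes : (G : Graph n) → HasSemiorders G k → HasCubeRepresentation G k
semiorders⇒cubes {n} {k} G (B , B? , semi , adj) = (λ v i → rational (f i v)) , λ u v u≢v → mk⇔
  (λ uv → from (meet u v) λ i → let p , q = to (adj u v u≢v) uv i in
     from (≤⊕ i u v) (to (correct i u v u≢v) p) ,
     from (≤⊕ i v u) (to (correct i v u (≢-sym u≢v)) q))
  (λ m → from (adj u v u≢v) λ i →
     from (correct i u v u≢v) (to (≤⊕ i u v) (proj₁ (to (meet u v) m i))) ,
     from (correct i v u (≢-sym u≢v)) (to (≤⊕ i v u) (proj₂ (to (meet u v) m i))))
  where
  f : Fin k → Fin n → ℚ
  f i = proj₁ (semiorder⇒rational (B? i) (semi i))
  correct : ∀ i u v → u ≢ v → B i u v ⇔ f i v ℚ.≤ f i u ℚ.+ 1ℚ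
  correct i = proj₂ (semiorder⇒rational (B? i) (semi i))
  ≤⊕ : ∀ i u v → rational (f i v) ≤ᴿ rational (f i u) ⊕ 1ℚ ⇔ f i v ℚ.≤ f i u ℚ.+ 1ℚ
  ≤⊕ i u v = rational-≤⊕ {f i v} {f i u} 1ℚ
  meet : ∀ u v → (Cube (λ i → rational (f i u)) U.≬ Cube (λ i → rational (f i v))) ⇔
    (∀ i → rational (f i v) ≤ᴿ rational (f i u) ⊕ 1ℚ × rational (f i u) ≤ᴿ rational (f i v) ⊕ 1ℚ)
  meet u v = cubes-meet (λ i → rational (f i u)) (λ i → rational (f i v)) λ i →
    Sum.map rational-mono rational-mono (ℚ.≤-total (f i u) (f i v))

-- Existence of the cubicity.

hasCubes? : (G : Graph n) (k : ℕ) → Dec (HasCubeRepresentation G k)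
hasCubes? G k = map′ (semiorders⇒cubes G)
  (λ rep → decidable-stable (hasSemiorders? G k) (cubes⇒¬¬semiorders G rep)) (hasSemiorders? G k)

cubicity-≤ : (G : Graph n) → HasCubeRepresentation G k → ∃[ c ] IsCubicity G c × c ≤ k
cubicity-≤ {k = k} G = least k (<-wellFounded k)
  where
  least : ∀ m → Acc ℕ._<_ m → HasCubeRepresentation G m → ∃[ c ] IsCubicity G c × c ≤ m
  least m (acc smaller) rep with ℕ.anyUpTo? (hasCubes? G) m
  ... | yes (j , j<m , rep′) = let c , cub , c≤j = least j (smaller j<m) rep′ in
          c , cub , ℕ.≤-trans c≤j (ℕ.<⇒≤ j<m)
  ... | no none = m , (rep , λ j rep′ → ℕ.≮⇒≥ λ j<m → none (j , j<m , rep′)) , ℕ.≤-refl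

-- Graphs of bounded bandwidth

≤-max : (f : Fin n → ℕ) (v : Fin n) → f v ≤ max 0 (map f (allFin n))
≤-max f v = All.lookup (xs≤max 0 _) (∈-map⁺ f (∈-allFin v))

quotient-unique : ∀ x t b .{{_ : NonZero b}} → t * b ≤ x → x < suc t * b → x / b ≡ t
quotient-unique x t b lo hi = ℕ.≤-antisym (ℕ.≤-pred (m<n*o⇒m/o<n {n = suc t} hi))
  (subst (_≤ x / b) (m*n/n≡m t b) (/-monoˡ-≤ b lo))

-- This supplies the shift that turns a chosen vertex into the head of a block.
complete-block : ∀ x b .{{_ : NonZero b}} → (x + (b ∸ x % b)) % b ≡ 0
complete-block x b = trans (cong (_% b) eq) (m*n%n≡0 (suc (x / b)) b)
  where
  open ≡-Reasoning
  eq : x + (b ∸ x % b) ≡ suc (x / b) * b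
  eq = begin
    x + (b ∸ x % b)                     ≡⟨ cong (_+ (b ∸ x % b)) (m≡m%n+[m/n]*n x b) ⟩
    x % b + x / b * b + (b ∸ x % b)     ≡⟨ cong (_+ (b ∸ x % b)) (ℕ.+-comm (x % b) _) ⟩
    x / b * b + x % b + (b ∸ x % b)     ≡⟨ ℕ.+-assoc (x / b * b) _ _ ⟩
    x / b * b + (x % b + (b ∸ x % b))   ≡⟨ cong (λ s → x / b * b + s)
                                             (ℕ.m+[n∸m]≡n (ℕ.<⇒≤ (m%n<n x b))) ⟩
    x / b * b + b                       ≡⟨ ℕ.+-comm _ b ⟩
    suc (x / b) * b                     ∎

Threshold : (Fin n → ℕ) → ℕ → Rel (Fin n) 0ℓ
Threshold f N u v = f v ≤ f u + N

threshold-semiorder : (f : Fin n → ℕ) (N : ℕ) → IsSemiorder (Threshold f N)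
threshold-semiorder f N = (λ u → ℕ.m≤m+n (f u) N) ,
  (λ u v → Sum.map trace trace (ℕ.≤-total (f u) (f v)))
  where
  trace : ∀ {u v} → f u ≤ f v → Trace (Threshold f N) u v
  trace u≤v w = (λ w≤ → ℕ.≤-trans w≤ (ℕ.+-monoˡ-≤ N u≤v)) , ℕ.≤-trans u≤v

module _ (G : Graph n) (q : Fin n → ℕ) (q-injective : Injective _≡_ _≡_ q) (b : ℕ)
         (band : ∀ {u v} → Adj G u v → q v ≤ q u + b) where

  -- As `q` is injective, each `u` has at most one vertex exactly `b` to its right, and there the
  -- relation is free to copy adjacency.
  Long : Rel (Fin n) 0ℓ
  Long u v = q v ≤ q u ⊎ q v < q u + b ⊎ (q v ≡ q u + b × Adj G u v)

  long? : Decidable Long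
  long? u v = (q v ℕ.≤? q u) ⊎-dec (q v ℕ.<? q u + b) ⊎-dec
              ((q v ℕ.≟ q u + b) ×-dec adj? G u v)

  -- If `q u < q v`, the borderline distance `b` from `u` to `w`, or from `w` to `v`, becomes
  -- strictly smaller when `u` and `v` are exchanged.
  long-semiorder : IsSemiorder Long
  long-semiorder = (λ u → inj₁ ℕ.≤-refl) ,
    (λ u v → Sum.map trace trace (ℕ.≤-total (q u) (q v)))
    where
    trace : ∀ {u v} → q u ≤ q v → Trace Long u v
    trace {u} {v} u≤v w with ℕ.m≤n⇒m<n∨m≡n u≤v
    ... | inj₂ u≡v with refl ← q-injective u≡v = id , id
    ... | inj₁ u<v = forward , backward
      where
      forward : Long u w → Long v w
      forward (inj₁ w≤u) = inj₁ (ℕ.≤-trans w≤u u≤v)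
      forward (inj₂ (inj₁ w<)) = inj₂ (inj₁ (ℕ.<-≤-trans w< (ℕ.+-monoˡ-≤ b u≤v)))
      forward (inj₂ (inj₂ (w≡ , _))) =
        inj₂ (inj₁ (subst (_< q v + b) (sym w≡) (ℕ.+-monoˡ-< b u<v)))
      backward : Long w v → Long w u
      backward (inj₁ v≤w) = inj₁ (ℕ.≤-trans u≤v v≤w)
      backward (inj₂ (inj₁ v<)) = inj₂ (inj₁ (ℕ.≤-<-trans u≤v v<))
      backward (inj₂ (inj₂ (v≡ , _))) = inj₂ (inj₁ (subst (q u <_) v≡ u<v))

  long-adj : ∀ {u v} → Adj G u v → Long u v
  long-adj {u} {v} a with ℕ.m≤n⇒m<n∨m≡n (band a)
  ... | inj₁ v< = inj₂ (inj₁ v<)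
  ... | inj₂ v≡ = inj₂ (inj₂ (v≡ , a))

  -- The positions, shifted by d, are cut into blocks of length b.  The heads of the
  -- blocks (of which an injective q gives at most one each) are sent to the block
  -- number t; every other vertex lies near N, at distance N or N + 1 from the head
  -- of its block according to whether it is adjacent to it.
  module _ .{{_ : NonZero b}} (d : ℕ) where

    x t : Fin n → ℕ
    x v = q v + d
    t v = x v / b

    -- Heads get coordinates below `N` and all other vertices get values from `N` to `N + N`, so two
    -- vertices of the same kind are never separated.
    N : ℕ
    N = suc (max 0 (map t (allFin n)))

    t<N : ∀ v → t v < N
    t<N v = ℕ.s≤s (≤-max t v)

    Head HeadNeighbour : Fin n → Set
    Head v = x v % b ≡ 0
    HeadNeighbour v = ∃[ w ] x w ≡ t v * b × Adj G w v

    data Coordinate (v : Fin n) : ℕ → Set where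
      isHead : Head v → Coordinate v (t v)
      isNear : ¬ Head v → HeadNeighbour v → Coordinate v (N + t v)
      isFar  : ¬ Head v → ¬ HeadNeighbour v → Coordinate v (N + suc (t v))

    coordinate : ∀ v → ∃ (Coordinate v)
    coordinate v with x v % b ℕ.≟ 0
    ... | yes h = _ , isHead h
    ... | no ¬h with Fin.any? (λ w → (x w ℕ.≟ t v * b) ×-dec adj? G w v)
    ...   | yes nb = _ , isNear ¬h nb
    ...   | no ¬nb = _ , isFar ¬h ¬nb

    block : Fin n → ℕ
    block v = proj₁ (coordinate v)

    head-position : ∀ {v} → Head v → x v ≡ t v * b
    head-position {v} h = trans (m≡m%n+[m/n]*n (x v) b) (cong (_+ t v * b) h)

    beyond-head : ∀ {v} → ¬ Head v → t v * b < x v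
    beyond-head {v} ¬h = ℕ.≤∧≢⇒< (m/n*n≤m (x v) b)
      λ eq → ¬h (trans (cong (_% b) (sym eq)) (m*n%n≡0 (t v) b))

    -- In a later block `v`, not being a head, would lie more than `b` beyond `u`, against `band`.
    adj-block≤ : ∀ {u v} → Head u → ¬ Head v → Adj G u v → t v ≤ t u
    adj-block≤ {u} {v} h ¬h a = ℕ.≮⇒≥ λ tu<tv → ℕ.<-irrefl refl (begin-strict
      x u + b         ≡⟨ cong (_+ b) (head-position h) ⟩
      t u * b + b     ≡⟨ ℕ.+-comm _ b ⟩
      suc (t u) * b   ≤⟨ ℕ.*-monoˡ-≤ b tu<tv ⟩
      t v * b         <⟨ beyond-head ¬h ⟩
      x v             ≤⟨ ℕ.+-monoˡ-≤ d (band a) ⟩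
      q u + b + d     ≡⟨ ℕ.+-assoc (q u) b d ⟩
      q u + (b + d)   ≡⟨ cong (λ s → q u + s) (ℕ.+-comm b d) ⟩
      q u + (d + b)   ≡⟨ ℕ.+-assoc (q u) d b ⟨
      x u + b         ∎)
      where open ℕ.≤-Reasoning

    upper : ∀ {v f} → Coordinate v f → f ≤ N + N
    upper {v} (isHead _) = ℕ.≤-trans (ℕ.<⇒≤ (t<N v)) (ℕ.m≤m+n N N)
    upper {v} (isNear _ _) = ℕ.+-monoʳ-≤ N (ℕ.<⇒≤ (t<N v))
    upper {v} (isFar _ _) = ℕ.+-monoʳ-≤ N (t<N v)

    -- Only a head `u` and a non-head `v` need an argument. If `v` is far, its block must be
    -- strictly earlier: in the same block `u` would be a head adjacent to `v`.
    block-adj : ∀ {u v f g} → Coordinate u f → Coordinate v g → Adj G u v → g ≤ f + N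
    block-adj (isNear _ _) cv a = ℕ.≤-trans (upper cv) (ℕ.+-monoˡ-≤ N (ℕ.m≤m+n N _))
    block-adj (isFar _ _) cv a = ℕ.≤-trans (upper cv) (ℕ.+-monoˡ-≤ N (ℕ.m≤m+n N _))
    block-adj {u} {v} (isHead _) (isHead _) a = ℕ.≤-trans (ℕ.<⇒≤ (t<N v)) (ℕ.m≤n+m N _)
    block-adj {u} {v} (isHead h) (isNear ¬h _) a =
      subst (_≤ t u + N) (ℕ.+-comm (t v) N) (ℕ.+-monoˡ-≤ N (adj-block≤ h ¬h a))
    block-adj {u} {v} (isHead h) (isFar ¬h ¬nb) a =
      subst (_≤ t u + N) (ℕ.+-comm (suc (t v)) N) (ℕ.+-monoˡ-≤ N
        (ℕ.≤∧≢⇒< (adj-block≤ h ¬h a)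
          λ tv≡tu → ¬nb (u , trans (head-position h) (cong (_* b) (sym tv≡tu)) , a)))

    -- The bounds put `v` in the block of `u`, beyond its head. That head is unique by injectivity
    -- of `q`, so `v` is far, at distance `N + 1`.
    block-separates : ∀ {u v f g} → Coordinate u f → Coordinate v g → Head u →
      q u < q v → q v < q u + b → ¬ Adj G u v → f + N < g
    block-separates {u} {v} cu cv h u<v v<u+b ¬a = go cu cv
      where
      tv≡tu : t v ≡ t u
      tv≡tu = quotient-unique (x v) (t u) b
        (subst (_≤ x v) (head-position h) (ℕ.+-monoˡ-≤ d (ℕ.<⇒≤ u<v)))
        (begin-strict
          x v             <⟨ ℕ.+-monoˡ-< d v<u+b ⟩
          q u + b + d     ≡⟨ cong (_+ d) (ℕ.+-comm (q u) b) ⟩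
          b + q u + d     ≡⟨ ℕ.+-assoc b (q u) d ⟩
          b + x u         ≡⟨ cong (λ s → b + s) (head-position h) ⟩
          suc (t u) * b   ∎)
        where open ℕ.≤-Reasoning
      xu≡ : x u ≡ t v * b
      xu≡ = trans (head-position h) (cong (_* b) (sym tv≡tu))
      go : ∀ {f g} → Coordinate u f → Coordinate v g → f + N < g
      go (isNear ¬h _) _ = ⊥-elim (¬h h)
      go (isFar ¬h _) _ = ⊥-elim (¬h h)
      go (isHead _) (isHead h′) =
        ⊥-elim (ℕ.<-irrefl (trans xu≡ (sym (head-position h′))) (ℕ.+-monoˡ-< d u<v))
      go (isHead _) (isNear _ (w , xw≡ , a)) = ⊥-elim (¬a (subst (λ w → Adj G w v)
        (q-injective (ℕ.+-cancelʳ-≡ d _ _ (trans xw≡ (sym xu≡)))) a))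
      go (isHead _) (isFar _ _) = ℕ.≤-reflexive
        (trans (ℕ.+-comm (suc (t u)) N) (cong (λ s → N + suc s) (sym tv≡tu)))

  coordinates : Fin (suc b) → Rel (Fin n) 0ℓ
  coordinates zero = Long
  coordinates (suc r) = Threshold (block d) (N d)
    where
    instance _ = Fin.nonZeroIndex r
    -- With this shift the heads are exactly the vertices whose position is congruent to `r` modulo
    -- `b`.
    d = b ∸ toℕ r

  bandwidth⇒semiorders : HasSemiorders G (suc b)
  bandwidth⇒semiorders = coordinates , dec , semi ,
    λ u v u≢v → mk⇔
      (λ a i → adj i a , adj i (Graph.symmetric G a))
      (λ near → decidable-stable (adj? G u v) λ ¬a → apart u≢v ¬a near)
    where
    dec : ∀ i → Decidable (coordinates i)
    dec zero = long?
    dec (suc r) u v = _ ℕ.≤? _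
    semi : ∀ i → IsSemiorder (coordinates i)
    semi zero = long-semiorder
    semi (suc r) = threshold-semiorder _ _
    adj : ∀ i {u v} → Adj G u v → coordinates i u v
    adj zero = long-adj
    adj (suc r) a = block-adj {{Fin.nonZeroIndex r}} _
      (proj₂ (coordinate {{_}} _ _)) (proj₂ (coordinate {{_}} _ _)) a
    separated : ∀ {u v} → q u < q v → ¬ Adj G u v → ¬ (∀ i → coordinates i u v)
    separated {u} {v} u<v ¬a near with near zero
    ... | inj₁ v≤u = ℕ.<⇒≱ u<v v≤u
    ... | inj₂ (inj₂ (_ , a)) = ¬a a
    ... | inj₂ (inj₁ v<u+b) = ℕ.<⇒≱
      (block-separates _ (proj₂ (coordinate _ u)) (proj₂ (coordinate _ v)) u-head u<v v<u+b ¬a)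
      (near (suc r))
      where
      instance
        nz : NonZero b
        -- `q v` lies strictly between `q u` and `q u + b`, which excludes `b = 0`.
        nz = ℕ.≢-nonZero λ { refl → ℕ.<-asym u<v (subst (q v <_) (ℕ.+-identityʳ (q u)) v<u+b) }
      r : Fin b
      r = q u mod b
      u-head : Head (b ∸ toℕ r) u
      u-head = subst (λ s → (q u + (b ∸ s)) % b ≡ 0)
        (sym (Fin.toℕ-fromℕ< (m%n<n (q u) b))) (complete-block (q u) b)
    apart : ∀ {u v} → u ≢ v → ¬ Adj G u v → ¬ (∀ i → coordinates i u v × coordinates i v u)
    apart {u} {v} u≢v ¬a near with ℕ.<-cmp (q u) (q v)
    ... | tri< u<v _ _ = separated u<v ¬a (proj₁ ∘ near)
    ... | tri≈ _ u≡v _ = u≢v (q-injective u≡v)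
    ... | tri> _ _ v<u = separated v<u (¬a ∘ Graph.symmetric G) (proj₂ ∘ near)

-- Cyclic numberings

length-filter-∪ : ∀ {A : Set} {P Q R : A → Set} (P? : U.Decidable P) (Q? : U.Decidable Q)
  (R? : U.Decidable R) → R U.⊆ P U.∪ Q → ∀ xs →
  length (filter R? xs) ≤ length (filter P? xs) + length (filter Q? xs)
length-filter-∪ P? Q? R? R⊆P∪Q [] = ℕ.z≤n
length-filter-∪ P? Q? R? R⊆P∪Q (x ∷ xs)
  with rec ← length-filter-∪ P? Q? R? R⊆P∪Q xs | R? x | P? x | Q? x
... | yes r | yes _ | yes _ = ℕ.s≤s (ℕ.≤-trans rec (ℕ.+-monoʳ-≤ _ (ℕ.n≤1+n _)))
... | yes r | yes _ | no _ = ℕ.s≤s rec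
... | yes r | no _ | yes _ = ℕ.≤-trans (ℕ.s≤s rec) (ℕ.≤-reflexive (sym (ℕ.+-suc _ _)))
... | yes r | no ¬p | no ¬q = ⊥-elim (Sum.[ ¬p , ¬q ] (R⊆P∪Q r))
... | no _ | yes _ | yes _ = ℕ.m≤n⇒m≤1+n (ℕ.≤-trans rec (ℕ.+-monoʳ-≤ _ (ℕ.n≤1+n _)))
... | no _ | yes _ | no _ = ℕ.m≤n⇒m≤1+n rec
... | no _ | no _ | yes _ = ℕ.≤-trans rec (ℕ.+-monoʳ-≤ _ (ℕ.n≤1+n _))
... | no _ | no _ | no _ = rec

length-filter-⊎ : ∀ {A : Set} {P Q R : A → Set} (P? : U.Decidable P) (Q? : U.Decidable Q)
  (R? : U.Decidable R) → P U.∪ Q U.⊆ R → (∀ {x} → P x → ¬ Q x) → ∀ xs →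
  length (filter P? xs) + length (filter Q? xs) ≤ length (filter R? xs)
length-filter-⊎ P? Q? R? P∪Q⊆R disj [] = ℕ.z≤n
length-filter-⊎ P? Q? R? P∪Q⊆R disj (x ∷ xs)
  with rec ← length-filter-⊎ P? Q? R? P∪Q⊆R disj xs | P? x | Q? x | R? x
... | yes p | yes q | _ = ⊥-elim (disj p q)
... | yes p | no _ | yes _ = ℕ.s≤s rec
... | no _ | yes q | yes _ = ℕ.≤-trans (ℕ.≤-reflexive (ℕ.+-suc _ _)) (ℕ.s≤s rec)
... | yes p | no _ | no ¬r = ⊥-elim (¬r (P∪Q⊆R (inj₁ p)))
... | no _ | yes q | no ¬r = ⊥-elim (¬r (P∪Q⊆R (inj₂ q)))
... | no _ | no _ | yes _ = ℕ.m≤n⇒m≤1+n rec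
... | no _ | no _ | no _ = rec

-- A cyclic sequence of n places, numbered x = 1, …, n and with y = n - x, is folded
-- into a linear one by interleaving its two halves.
data Fold (x y : ℕ) : ℕ → Set where
  low  : x ≤ y → Fold x y (2 * x)
  high : y < x → Fold x y (suc (2 * y))

fold : ∀ x y → ∃ (Fold x y)
fold x y with x ℕ.≤? y
... | yes x≤y = _ , low x≤y
... | no x≰y = _ , high (ℕ.≰⇒> x≰y)

-- Parity tells the two halves apart; within the second half `y` is recovered, and the sum `n` then
-- gives `x`.
fold-injective : ∀ {n x y x′ y′ a} → x + y ≡ n → x′ + y′ ≡ n →
                 Fold x y a → Fold x′ y′ a → x ≡ x′
fold-injective {x = x} {y} {x′} {y′} refl eq f f′ = go f f′ refl
  where
  go : ∀ {a a′} → Fold x y a → Fold x′ y′ a′ → a ≡ a′ → x ≡ x′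
  go (low _) (low _) e = ℕ.*-cancelˡ-≡ _ _ 2 e
  go (low _) (high _) e = ⊥-elim (ℕ.even≢odd x y′ e)
  go (high _) (low _) e = ⊥-elim (ℕ.even≢odd x′ y (sym e))
  go (high _) (high _) e with refl ← ℕ.*-cancelˡ-≡ y y′ 2 (ℕ.suc-injective e) =
    sym (ℕ.+-cancelʳ-≡ y x′ x eq)

-- The hypothesis bounds the cyclic distance by `D`, directly or through the cut: `x + y′` is `n`
-- minus `x′ - x`. Interleaving at most doubles it.
fold-near : ∀ {n x y x′ y′ a a′} D → x + y ≡ n → x′ + y′ ≡ n → 1 ≤ x → x ≤ x′ →
  x′ ≤ x + D ⊎ x + y′ ≤ D → Fold x y a → Fold x′ y′ a′ → a ≤ a′ + 2 * D × a′ ≤ a + 2 * D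
fold-near {n} {x} {y} {x′} {y′} D x+y x′+y′ 1≤x x≤x′ near = go
  where
  y′≤y : y′ ≤ y
  y′≤y = ℕ.+-cancelˡ-≤ x y′ y (ℕ.≤-trans (ℕ.+-monoˡ-≤ y′ x≤x′)
    (ℕ.≤-reflexive (trans x′+y′ (sym x+y))))
  y≤ : x′ ≤ x + D → y ≤ y′ + D
  y≤ x′≤ = ℕ.+-cancelˡ-≤ x y (y′ + D) (begin
    x + y         ≡⟨ trans x+y (sym x′+y′) ⟩
    x′ + y′       ≤⟨ ℕ.+-monoˡ-≤ y′ x′≤ ⟩
    x + D + y′    ≡⟨ ℕ.+-assoc x D y′ ⟩
    x + (D + y′)  ≡⟨ cong (λ s → x + s) (ℕ.+-comm D y′) ⟩
    x + (y′ + D)  ∎)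
    where open ℕ.≤-Reasoning
  double : ∀ {l m} → l ≤ m + D → 2 * l ≤ 2 * m + 2 * D
  double {l} {m} l≤ = subst (2 * l ≤_) (ℕ.*-distribˡ-+ 2 m D) (ℕ.*-monoʳ-≤ 2 l≤)
  double< : ∀ {l m} → l < m + D → 2 * l < 2 * m + 2 * D
  double< {l} {m} l< = subst (2 * l <_) (ℕ.*-distribˡ-+ 2 m D) (ℕ.*-monoʳ-< 2 l<)
  wrap-x : x + y′ ≤ D → x ≤ D
  wrap-x = ℕ.≤-trans (ℕ.m≤m+n x y′)
  wrap-y : x + y′ ≤ D → y′ ≤ D
  wrap-y = ℕ.≤-trans (ℕ.m≤n+m y′ x)
  x′≤x+D : x′ ≤ y′ → x′ ≤ x + D
  x′≤x+D x′≤y′ = Sum.[ id , (λ w → ℕ.≤-trans x′≤y′ (ℕ.m≤n⇒m≤o+n x (wrap-y w))) ] near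
  y≤y′+D : y < x → y ≤ y′ + D
  y≤y′+D y<x = Sum.[ y≤ , (λ w → ℕ.m≤n⇒m≤o+n y′ (ℕ.≤-trans (ℕ.<⇒≤ y<x) (wrap-x w))) ] near
  x≤y′+D : x ≤ y → x ≤ y′ + D
  x≤y′+D x≤y = Sum.[ ℕ.≤-trans x≤y ∘ y≤ , (λ w → ℕ.m≤n⇒m≤o+n y′ (wrap-x w)) ] near
  y′<x+D : y′ < x′ → y′ < x + D
  y′<x+D y′<x′ = Sum.[ ℕ.<-≤-trans y′<x′ ,
    -- Through the cut, `1 ≤ x` gives the strictness that pays for the `suc` in `high`.
    (λ w → ℕ.m≤n⇒m≤o+n x (ℕ.≤-trans (ℕ.+-monoˡ-≤ y′ 1≤x) w)) ] near
  go : ∀ {a a′} → Fold x y a → Fold x′ y′ a′ → a ≤ a′ + 2 * D × a′ ≤ a + 2 * D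
  go (low x≤y) (low x′≤y′) = double (ℕ.m≤n⇒m≤n+o D x≤x′) , double (x′≤x+D x′≤y′)
  go (low x≤y) (high y′<x′) = ℕ.m≤n⇒m≤1+n (double (x≤y′+D x≤y)) , double< (y′<x+D y′<x′)
  go (high y<x) (low x′≤y′) = ⊥-elim (ℕ.<-irrefl refl
    (ℕ.<-≤-trans y<x (ℕ.≤-trans x≤x′ (ℕ.≤-trans x′≤y′ y′≤y))))
  go (high y<x) (high y′<x′) =
    ℕ.s≤s (double (y≤y′+D y<x)) , ℕ.s≤s (double (ℕ.m≤n⇒m≤n+o D y′≤y))

module _ (G : Graph n) {_⊑_ : Rel (Fin n) 0ℓ} (order : IsDecTotalOrder _≡_ _⊑_) where

  private module O = IsDecTotalOrder order
  open O using (_≟_) renaming (_≤?_ to _⊑?_)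

  -- In the second case the run from u to v passes through the cut point of the circle.
  Run : Rel (Fin n) 0ℓ
  Run u v = (u ⊑ v × (∀ {w} → ¬ (w ⊑ u) → w ⊑ v → Adj G u w)) ⊎
            (v ⊑ u × (∀ {w} → ¬ (w ⊑ u) ⊎ w ⊑ v → Adj G u w))

  count : {P : Fin n → Set} → U.Decidable P → ℕ
  count P? = length (filter P? (allFin n))

  rank corank : Fin n → ℕ
  rank v = count (_⊑? v)
  corank v = n ∸ rank v

  rank-mono-< : ∀ {u v} → u ⊑ v → u ≢ v → rank u < rank v
  rank-mono-< {u} {v} u⊑v u≢v = ℕ.≤-trans
    (subst (_≤ rank u + count (_≟ v)) (ℕ.+-comm (rank u) 1)
      (ℕ.+-monoʳ-≤ (rank u) (∈-length (∈-filter⁺ (_≟ v) (∈-allFin v) refl))))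
    (length-filter-⊎ (_⊑? u) (_≟ v) (_⊑? v)
      (λ { (inj₁ w⊑u) → O.trans w⊑u u⊑v ; (inj₂ refl) → O.refl })
      (λ { v⊑u refl → u≢v (O.antisym u⊑v v⊑u) }) (allFin n))

  rank-mono-≤ : ∀ {u v} → u ⊑ v → rank u ≤ rank v
  rank-mono-≤ {u} {v} u⊑v with u ≟ v
  ... | yes refl = ℕ.≤-refl
  ... | no u≢v = ℕ.<⇒≤ (rank-mono-< u⊑v u≢v)

  rank-injective : ∀ {u v} → rank u ≡ rank v → u ≡ v
  rank-injective {u} {v} eq = decidable-stable (u ≟ v) λ u≢v → Sum.[
    (λ u⊑v → ℕ.<-irrefl eq (rank-mono-< u⊑v u≢v)) ,
    (λ v⊑u → ℕ.<-irrefl (sym eq) (rank-mono-< v⊑u (≢-sym u≢v))) ] (O.total u v)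

  rank+corank : ∀ v → rank v + corank v ≡ n
  rank+corank v = ℕ.m+[n∸m]≡n
    (subst (rank v ≤_) (length-tabulate {n = n} id) (length-filter (_⊑? v) (allFin n)))

  rank-positive : ∀ v → 1 ≤ rank v
  rank-positive v = ∈-length (∈-filter⁺ (_⊑? v) (∈-allFin v) O.refl)

  Close : Rel (Fin n) 0ℓ
  Close u v = rank u ≤ rank v ×
    (rank v ≤ rank u + maxDegree G ⊎ rank u + corank v ≤ maxDegree G)

  -- The vertices of the run after `u` are neighbours of `u`, hence at most `maxDegree G` many.
  -- Through the cut they form two disjoint sets, of sizes `corank u` and `rank v`.
  run⇒close : ∀ {u v} → Run u v → Close u v ⊎ Close v u
  run⇒close {u} {v} (inj₁ (u⊑v , run)) = inj₁ (rank-mono-≤ u⊑v , inj₁ (ℕ.≤-trans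
    (length-filter-∪ (_⊑? u) (adj? G u) (_⊑? v) split (allFin n))
    (ℕ.+-monoʳ-≤ (rank u) (≤-max (degree G) u))))
    where
    split : ∀ {w} → w ⊑ v → w ⊑ u ⊎ Adj G u w
    split {w} w⊑v with w ⊑? u
    ... | yes w⊑u = inj₁ w⊑u
    ... | no w⋢u = inj₂ (run w⋢u w⊑v)
  run⇒close {u} {v} (inj₂ (v⊑u , run)) = inj₂ (rank-mono-≤ v⊑u , inj₂ (begin
    rank v + corank u               ≤⟨ ℕ.+-monoʳ-≤ (rank v) corank≤ ⟩
    rank v + count (¬? ∘ (_⊑? u))   ≤⟨ length-filter-⊎ (_⊑? v) (¬? ∘ (_⊑? u)) (adj? G u)
                                         (run ∘ Sum.swap)
                                         (λ w⊑v w⋢u → w⋢u (O.trans w⊑v v⊑u)) (allFin n) ⟩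
    degree G u                      ≤⟨ ≤-max (degree G) u ⟩
    maxDegree G                     ∎))
    where
    open ℕ.≤-Reasoning
    split : ∀ {w} → ⊤ → w ⊑ u ⊎ ¬ (w ⊑ u)
    split {w} _ with w ⊑? u
    ... | yes w⊑u = inj₁ w⊑u
    ... | no w⋢u = inj₂ w⋢u
    all : count (λ _ → yes tt) ≡ n
    all = trans (cong length (filter-all (λ _ → yes tt) (All.tabulate {xs = allFin n} _)))
                (length-tabulate id)
    corank≤ : corank u ≤ count (¬? ∘ (_⊑? u))
    corank≤ = ℕ.m≤n+o⇒m∸n≤o n (rank u) (subst (_≤ rank u + count (¬? ∘ (_⊑? u))) all
      (length-filter-∪ (_⊑? u) (¬? ∘ (_⊑? u)) (λ _ → yes tt) split (allFin n)))

  position : Fin n → ℕ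
  position v = proj₁ (fold (rank v) (corank v))

  position-fold : ∀ v → Fold (rank v) (corank v) (position v)
  position-fold v = proj₂ (fold (rank v) (corank v))

  close⇒near : ∀ {u v} → Close u v →
    position u ≤ position v + 2 * maxDegree G × position v ≤ position u + 2 * maxDegree G
  close⇒near {u} {v} (u≤v , near) = fold-near (maxDegree G) (rank+corank u) (rank+corank v)
    (rank-positive u) u≤v near (position-fold u) (position-fold v)

  runs⇒semiorders : (∀ {u v} → Adj G u v → Run u v ⊎ Run v u) →
                    HasSemiorders G (suc (2 * maxDegree G))
  runs⇒semiorders runs = bandwidth⇒semiorders G position
    (λ {u} {v} eq → rank-injective (fold-injective (rank+corank u) (rank+corank v)
      (position-fold u) (subst (Fold _ _) (sym eq) (position-fold v))))
    (2 * maxDegree G)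
    (λ {u} {v} a → Sum.[ proj₂ ∘ close⇒near , proj₁ ∘ close⇒near ]′
      (Sum.[ run⇒close , Sum.swap ∘ run⇒close ]′ (runs a)))

-- Circular arcs

ι : ℤ → ℚ
ι i = i ℚ./ 1

ι≡mkℚ : ∀ i → ι i ≡ mkℚ i 0 (Coprime.sym (Coprime.1-coprimeTo ∣ i ∣))
ι≡mkℚ i = ℚ.↥p/↧p≡p (mkℚ i 0 (Coprime.sym (Coprime.1-coprimeTo ∣ i ∣)))

ι-+ : ∀ i j → ι (i ℤ.+ j) ≡ ι i ℚ.+ ι j
ι-+ i j rewrite ι≡mkℚ i | ι≡mkℚ j =
  cong (ℚ._/ 1) (sym (cong₂ ℤ._+_ (ℤ.*-identityʳ i) (ℤ.*-identityʳ j)))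

ι-archimedean : ∀ q → ∃[ m ] q ℚ.< ι (+ m)
ι-archimedean q@(mkℚ i d _) = suc ∣ i ∣ ,
  subst (q ℚ.<_) (sym (ι≡mkℚ (+ suc ∣ i ∣))) (*<* (begin-strict
    i ℤ.* 1ℤ                  ≡⟨ ℤ.*-identityʳ i ⟩
    i                         ≤⟨ i≤∣i∣ i ⟩
    + ∣ i ∣                   <⟨ ℤ.+<+ (ℕ.n<1+n ∣ i ∣) ⟩
    + suc ∣ i ∣               ≤⟨ ℤ.+≤+ (ℕ.m≤m*n (suc ∣ i ∣) (suc d)) ⟩
    + (suc ∣ i ∣ * suc d)   ≡⟨ ℤ.pos-* (suc ∣ i ∣) (suc d) ⟩
    + suc ∣ i ∣ ℤ.* + suc d   ∎))
  where
  open ℤ.≤-Reasoning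
  i≤∣i∣ : ∀ i → i ℤ.≤ + ∣ i ∣
  i≤∣i∣ (+ _) = ℤ.≤-refl
  i≤∣i∣ -[1+ _ ] = ℤ.-≤+

ι-neg : ∀ i → ι (ℤ.- i) ≡ ℚ.- ι i
ι-neg i = ℚ-group.inverseʳ-unique (ι i) (ι (ℤ.- i))
  (trans (sym (ι-+ i (ℤ.- i))) (cong ι (ℤ.+-inverseʳ i)))

-- (x , i) stands for the real number x + i.  This is a record because the arguments of
-- _≤ᴿ_ cannot be inferred.
infix 4 _≼_
record _≼_ (p q : ℝ × ℤ) : Set where
  constructor le
  field
    get : proj₁ p ⊕ ι (proj₂ p) ≤ᴿ proj₁ q ⊕ ι (proj₂ q)
open _≼_

≼-refl : ∀ {p} → p ≼ p
≼-refl = le id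

≼-trans : ∀ {p q r} → p ≼ q → q ≼ r → p ≼ r
≼-trans (le p≤q) (le q≤r) = le λ {s} h → q≤r {s} (p≤q {s} h)

-- The comparison depends only on `i - j`; the equation says that `i′ - j′` is the same. The tested
-- rational is moved by `ι i′ - ι i`.
≼-shift : ∀ {x y i j i′ j′} → (x , i) ≼ (y , j) → i ℤ.+ j′ ≡ i′ ℤ.+ j → (x , i′) ≼ (y , j′)
≼-shift {x} {y} {i} {j} {i′} {j′} (le x≤y) eq = le λ {p} p∈ →
  subst (U._∈ L y) (second p)
    (x≤y {p ℚ.- (ι i′ ℚ.- ι i)} (subst (U._∈ L x) (first p (ι i) (ι i′)) p∈))
  where
  open +-*-Solver
  open ≡-Reasoning
  first : ∀ p a b → p ℚ.- b ≡ p ℚ.- (b ℚ.- a) ℚ.- a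
  first = solve 3 (λ p a b → p :- b := p :- (b :- a) :- a) refl
  regroup : ∀ p a b c → p ℚ.- (b ℚ.- a) ℚ.- c ≡ p ℚ.+ a ℚ.- (b ℚ.+ c)
  regroup = solve 4 (λ p a b c → p :- (b :- a) :- c := p :+ a :- (b :+ c)) refl
  cancel : ∀ p a d → p ℚ.+ a ℚ.- (a ℚ.+ d) ≡ p ℚ.- d
  cancel = solve 3 (λ p a d → p :+ a :- (a :+ d) := p :- d) refl
  second : ∀ p → p ℚ.- (ι i′ ℚ.- ι i) ℚ.- ι j ≡ p ℚ.- ι j′
  second p = begin
    p ℚ.- (ι i′ ℚ.- ι i) ℚ.- ι j     ≡⟨ regroup p (ι i) (ι i′) (ι j) ⟩
    p ℚ.+ ι i ℚ.- (ι i′ ℚ.+ ι j)     ≡⟨ cong (λ s → p ℚ.+ ι i ℚ.- s)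
                                          (trans (sym (ι-+ i′ j)) (trans (cong ι (sym eq)) (ι-+ i j′))) ⟩
    p ℚ.+ ι i ℚ.- (ι i ℚ.+ ι j′)     ≡⟨ cancel p (ι i) (ι j′) ⟩
    p ℚ.- ι j′                       ∎

private
  p-0 : ∀ p → p ℚ.- 0ℚ ≡ p
  p-0 = ℚ.+-identityʳ

≤ᴿ⇔≼ʳ : ∀ x y i → x ≤ᴿ y ⊕ ι i ⇔ (x , 0ℤ) ≼ (y , i)
≤ᴿ⇔≼ʳ x y i = mk⇔
  (λ x≤y → le λ {p} p∈ → subst (λ r → r ℚ.- ι i U.∈ L y) (p-0 p) (x≤y {p ℚ.- 0ℚ} p∈))
  (λ x≼y {p} p∈ → get x≼y {p} (subst (U._∈ L x) (sym (p-0 p)) p∈))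

≤ᴿ⇔≼ˡ : ∀ x y i → x ⊕ ι i ≤ᴿ y ⇔ (x , i) ≼ (y , 0ℤ)
≤ᴿ⇔≼ˡ x y i = mk⇔
  (λ x≤y → le λ {p} p∈ → subst (U._∈ L y) (sym (p-0 p)) (x≤y {p} p∈))
  (λ x≼y {p} p∈ → subst (U._∈ L y) (p-0 p) (get x≼y {p} p∈))

≰⇒≽ : ∀ {p q} → ¬ (p ≼ q) → q ≼ p
≰⇒≽ {x , i} {y , j} p⋠q = le λ {s} → ≰ᴿ⇒≥ᴿ (x ⊕ ι i) (y ⊕ ι j) (λ h → p⋠q (le λ {r} → h {r})) {s}

≼-raise : ∀ {x} i m → (x , i) ≼ (x , + m ℤ.+ i)
≼-raise {x} i zero = subst (λ j → (x , i) ≼ (x , j)) (sym (ℤ.+-identityˡ i)) ≼-refl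
≼-raise {x} i (suc m) = ≼-trans (≼-raise i m)
  (≼-shift (to (≤ᴿ⇔≼ʳ x x 1ℤ) (x≤x⊕1 x)) (eq (+ m) i))
  where
  eq : ∀ m i → 0ℤ ℤ.+ ((1ℤ ℤ.+ m) ℤ.+ i) ≡ (m ℤ.+ i) ℤ.+ 1ℤ
  eq = solve-∀

-- This is `0 ≤ x + i < 1`, expressed by the upper cut.
Reduced : ℝ × ℤ → Set
Reduced (x , i) = 0ℚ U.∉ U (x ⊕ ι i) × 1ℚ U.∈ U (x ⊕ ι i)

-- Some `q < 1` is above `x + i`. As `y + j` is not below 0, locating it against `q - 1 < 0` puts
-- `q - 1` below it; the comparison would then put `q` below `x + i`.
reduced-⋠ : ∀ {x y i j} → Reduced (x , i) → Reduced (y , j) → ¬ ((y , j ℤ.+ 1ℤ) ≼ (x , i))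
reduced-⋠ {x} {y} {i} {j} (_ , 1∈Ux) (0∉Uy , _) y+1≼x with to (U-rounded (x ⊕ ι i) 1ℚ) 1∈Ux
... | q , q<1 , q∈Ux with located (y ⊕ ι j) (q ℚ.- 1ℚ) 0ℚ (ℚ.+-monoˡ-< (ℚ.- 1ℚ) q<1)
...   | inj₂ 0∈Uy = 0∉Uy 0∈Uy
...   | inj₁ q-1∈Ly = disjoint (x ⊕ ι i) q (get y+1≼x {q} (subst (U._∈ L y) eq q-1∈Ly) , q∈Ux)
  where
  open +-*-Solver
  eq : q ℚ.- 1ℚ ℚ.- ι j ≡ q ℚ.- ι (j ℤ.+ 1ℤ)
  eq = trans (solve 3 (λ q a b → q :- a :- b := q :- (b :+ a)) refl q 1ℚ (ι j))
             (cong (λ s → q ℚ.- s) (sym (ι-+ j 1ℤ)))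

-- Membership in `U x` is not decidable, hence the double negation. The search climbs from `- m`,
-- below `x`, to `m′`, above it.
¬¬-floor : ∀ x → ¬ ¬ (∃[ a ] ι a U.∉ U x × ι (1ℤ ℤ.+ a) U.∈ U x)
¬¬-floor x none with L-inhabited x | U-inhabited x
... | l , l∈L | u , u∈U with ι-archimedean (ℚ.- l) | ι-archimedean u
...   | m , -l<m | m′ , u<m′ = search (m ℕ.+ m′) (ℤ.- + m)
  (λ -m∈U → disjoint x (ι (ℤ.- + m)) (L-downward x -m<l l∈L , -m∈U))
  (subst (λ i → ι i U.∈ U x) (trans (eq (+ m) (+ m′)) (cong (ℤ._+ (ℤ.- + m)) (sym (ℤ.pos-+ m m′))))
    (from (U-rounded x _) (u , u<m′ , u∈U)))
  where
  step : ∀ j a → (1ℤ ℤ.+ j) ℤ.+ a ≡ j ℤ.+ (1ℤ ℤ.+ a)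
  step = solve-∀
  search : ∀ j a → ι a U.∉ U x → ι (+ j ℤ.+ a) U.∈ U x → ⊥
  search zero a a∉ a∈ = a∉ (subst (λ i → ι i U.∈ U x) (ℤ.+-identityˡ a) a∈)
  search (suc j) a a∉ top∈ = ¬¬-excluded-middle {A = ι (1ℤ ℤ.+ a) U.∈ U x} λ where
    (yes 1+a∈) → none (a , a∉ , 1+a∈)
    (no 1+a∉) → search j (1ℤ ℤ.+ a) 1+a∉ (subst (λ i → ι i U.∈ U x) (step (+ j) a) top∈)
  eq : ∀ m m′ → m′ ≡ (m ℤ.+ m′) ℤ.+ (ℤ.- m)
  eq = solve-∀
  -m<l : ι (ℤ.- + m) ℚ.< l
  -m<l = subst₂ ℚ._<_ (sym (ι-neg (+ m))) (ℚ-group.⁻¹-involutive l) (ℚ.neg-antimono-< -l<m)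

¬¬-reduce : ∀ x → ¬ ¬ (∃[ i ] Reduced (x , i))
¬¬-reduce x none = ¬¬-floor x λ (a , a∉U , 1+a∈U) → none (ℤ.- a ,
  (λ 0∈ → a∉U (subst (U._∈ U x) (trans (cong (λ s → 0ℚ ℚ.- s) (ι-neg a)) (zero- (ι a))) 0∈)) ,
  subst (U._∈ U x)
    (trans (ι-+ 1ℤ a) (trans (one- (ι a)) (cong (λ s → 1ℚ ℚ.- s) (sym (ι-neg a))))) 1+a∈U)
  where
  open +-*-Solver
  zero- : ∀ a → 0ℚ ℚ.- (ℚ.- a) ≡ a
  zero- = solve 1 (λ a → con 0ℚ :- (:- a) := a) refl
  one- : ∀ a → ι 1ℤ ℚ.+ a ≡ 1ℚ ℚ.- (ℚ.- a)
  one- = solve 1 (λ a → con 1ℚ :+ a := con 1ℚ :- (:- a)) refl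

-- Lifted arcs and their starting points.

module _ (G : Graph n) (arc : Fin n → Arc) (rep : IsIntersectionGraph G (λ v → ⟦ arc v ⟧))
         (reduction : ∀ v → ∃[ i ] Reduced (Arc.start (arc v) , i)) where

  open Arc

  -- The arcs are translated so that all starting points lie in [0, 1).
  offset : Fin n → ℤ
  offset v = proj₁ (reduction v)

  S E S+1 : Fin n → ℝ × ℤ
  S v = start (arc v) , offset v
  E v = end (arc v) , offset v
  S+1 v = start (arc v) , offset v ℤ.+ 1ℤ

  S+1⋠S : ∀ u v → ¬ (S+1 v ≼ S u)
  S+1⋠S u v = reduced-⋠ {j = offset v} (proj₂ (reduction u)) (proj₂ (reduction v))

  S≼S+1 : ∀ u v → S u ≼ S+1 v
  S≼S+1 u v = ≰⇒≽ (S+1⋠S u v)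

  S≼E : ∀ v → S v ≼ E v
  S≼E v = le λ {p} → start≤end (arc v) {p ℚ.- ι (offset v)}

  E≼S+1 : ∀ v → E v ≼ S+1 v
  E≼S+1 v = ≼-shift
    (to (≤ᴿ⇔≼ʳ (end (arc v)) (start (arc v)) 1ℤ) (end≤start+1 (arc v))) (eq (offset v))
    where
    eq : ∀ i → 0ℤ ℤ.+ (i ℤ.+ 1ℤ) ≡ i ℤ.+ 1ℤ
    eq = solve-∀

  Hits : Rel (Fin n) 0ℓ
  Hits u v = ∃[ m ] S u ≼ (start (arc v) , offset v ℤ.+ m) × (start (arc v) , offset v ℤ.+ m) ≼ E u

  -- The starting point of `v` is common to both arcs; `m′` carries it into the arc of `u` as given,
  -- before the translation by `offset u`.
  hits⇒adj : ∀ {u v} → u ≢ v → Hits u v → Adj G u v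
  hits⇒adj {u} {v} u≢v (m , lo , hi) = from (rep u v u≢v) (start (arc v) ,
    (m′ , (λ {p} → from (≤ᴿ⇔≼ʳ (start (arc u)) (start (arc v)) m′) (≼-shift lo eq₁) {p}) ,
          (λ {p} → from (≤ᴿ⇔≼ˡ (start (arc v)) (end (arc u)) m′) (≼-shift hi eq₂) {p})) ,
    (0ℤ , (λ {p} → from (≤ᴿ⇔≼ʳ (start (arc v)) (start (arc v)) 0ℤ) ≼-refl {p}) ,
          (λ {p} → from (≤ᴿ⇔≼ˡ (start (arc v)) (end (arc v)) 0ℤ)
                       (≼-shift (S≼E v) (ℤ.+-comm (offset v) 0ℤ)) {p})))
    where
    m′ = offset v ℤ.+ m ℤ.- offset u
    ring₁ : ∀ i j m → i ℤ.+ (j ℤ.+ m ℤ.- i) ≡ 0ℤ ℤ.+ (j ℤ.+ m)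
    ring₁ = solve-∀
    ring₂ : ∀ i j m → (j ℤ.+ m) ℤ.+ 0ℤ ≡ (j ℤ.+ m ℤ.- i) ℤ.+ i
    ring₂ = solve-∀
    eq₁ : offset u ℤ.+ m′ ≡ 0ℤ ℤ.+ (offset v ℤ.+ m)
    eq₁ = ring₁ (offset u) (offset v) m
    eq₂ : (offset v ℤ.+ m) ℤ.+ 0ℤ ≡ m′ ℤ.+ offset u
    eq₂ = ring₂ (offset u) (offset v) m

  hits₀⇒adj : ∀ {u v} → u ≢ v → S u ≼ S v → S v ≼ E u → Adj G u v
  hits₀⇒adj {u} {v} u≢v lo hi = hits⇒adj u≢v (0ℤ ,
    subst (λ i → S u ≼ (start (arc v) , i)) (sym (ℤ.+-identityʳ _)) lo ,
    subst (λ i → (start (arc v) , i) ≼ E u) (sym (ℤ.+-identityʳ _)) hi)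

  hits₁⇒adj : ∀ {u v} → u ≢ v → S+1 v ≼ E u → Adj G u v
  hits₁⇒adj {u} {v} u≢v hi = hits⇒adj u≢v (1ℤ , S≼S+1 u v , hi)

  -- Of two lifted arcs sharing a point, the one starting first hits the other.
  meet⇒hits : ∀ {u v x m m′} → (x , m) ≼ (end (arc u) , 0ℤ) →
    (start (arc v) , 0ℤ) ≼ (x , m′) → (start (arc u) , ℤ.- m) ≼ (start (arc v) , ℤ.- m′) → Hits u v
  meet⇒hits {u} {v} {x} {m} {m′} x≤Eu Sv≤x Su≤Sv = offset u ℤ.- offset v ℤ.+ m ℤ.- m′ ,
    ≼-shift Su≤Sv (ring₁ (offset u) (offset v) m m′) ,
    ≼-shift (≼-trans (≼-shift {i′ = m ℤ.- m′} Sv≤x (ring₂ m m′)) x≤Eu) (ring₃ (offset u) (offset v) m m′)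
    where
    ring₁ : ∀ i j m m′ → ℤ.- m ℤ.+ (j ℤ.+ (i ℤ.- j ℤ.+ m ℤ.- m′)) ≡ i ℤ.+ ℤ.- m′
    ring₁ = solve-∀
    ring₂ : ∀ m m′ → 0ℤ ℤ.+ m ≡ (m ℤ.- m′) ℤ.+ m′
    ring₂ = solve-∀
    ring₃ : ∀ i j m m′ → (m ℤ.- m′) ℤ.+ i ≡ (j ℤ.+ (i ℤ.- j ℤ.+ m ℤ.- m′)) ℤ.+ 0ℤ
    ring₃ = solve-∀

  -- Excluded middle decides which of the two lifts through the common point starts first.
  adj⇒¬¬hits : ∀ {u v} → Adj G u v → ¬ ¬ (Hits u v ⊎ Hits v u)
  adj⇒¬¬hits {u} {v} a none
    with to (rep u v (λ u≡v → Graph.irreflexive G u≡v a)) a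
  ... | x , (m , Su≤x , x≤Eu) , (m′ , Sv≤x , x≤Ev) =
    ¬¬-excluded-middle {A = (start (arc u) , ℤ.- m) ≼ (start (arc v) , ℤ.- m′)} λ where
      (yes Su≤Sv) → none (inj₁ (meet⇒hits {m = m} (to (≤ᴿ⇔≼ˡ x (end (arc u)) m) x≤Eu)
                                          (to (≤ᴿ⇔≼ʳ (start (arc v)) x m′) Sv≤x) Su≤Sv))
      (no Su≰Sv) → none (inj₂ (meet⇒hits {m = m′} (to (≤ᴿ⇔≼ˡ x (end (arc v)) m′) x≤Ev)
                                         (to (≤ᴿ⇔≼ʳ (start (arc u)) x m) Su≤x) (≰⇒≽ Su≰Sv)))

  module _ (S≼S? : Decidable (λ u v → S u ≼ S v)) where

    -- Equal starting points are ordered by vertex index, which makes the order antisymmetric for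
    -- `_≡_`.
    _⊑_ : Rel (Fin n) 0ℓ
    u ⊑ v = S u ≼ S v × (S v ≼ S u → u Fin≤ v)

    ⊑-trans : ∀ {u v w} → u ⊑ v → v ⊑ w → u ⊑ w
    ⊑-trans (u≼v , tie-uv) (v≼w , tie-vw) = ≼-trans u≼v v≼w , λ w≼u →
      Fin.≤-trans (tie-uv (≼-trans v≼w w≼u)) (tie-vw (≼-trans w≼u u≼v))

    ⊑-total : ∀ u v → u ⊑ v ⊎ v ⊑ u
    ⊑-total u v with S≼S? u v | S≼S? v u
    ... | no u⋠v | _ = inj₂ (≰⇒≽ u⋠v , ⊥-elim ∘ u⋠v)
    ... | _ | no v⋠u = inj₁ (≰⇒≽ v⋠u , ⊥-elim ∘ v⋠u)
    ... | yes u≼v | yes v≼u = Sum.map (λ u≤v → u≼v , λ _ → u≤v) (λ v≤u → v≼u , λ _ → v≤u)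
                                      (Fin.≤-total u v)

    ⋢⇒⊒ : ∀ {u v} → ¬ (u ⊑ v) → v ⊑ u
    ⋢⇒⊒ {u} {v} u⋢v = Sum.[ ⊥-elim ∘ u⋢v , id ]′ (⊑-total u v)

    ⊑-isDecTotalOrder : IsDecTotalOrder _≡_ _⊑_
    ⊑-isDecTotalOrder = record
      { isTotalOrder = record
        { isPartialOrder = record
          { isPreorder = record
            { isEquivalence = isEquivalence
            ; reflexive = λ { refl → ≼-refl , λ _ → Fin.≤-refl }
            ; trans = ⊑-trans
            }
          ; antisym = λ (u≼v , tie-uv) (v≼u , tie-vu) → Fin.≤-antisym (tie-uv v≼u) (tie-vu u≼v)
          }
        ; total = ⊑-total
        }
      ; _≟_ = Fin._≟_
      ; _≤?_ = λ u v → S≼S? u v ×-dec (S≼S? v u →-dec u Fin.≤? v)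
      }

    -- Starting points lie in [0, 1) and arcs have length at most 1, so only the translates by 0 and
    -- 1 can be hit.
    hits⇒0or1 : ∀ {u v} → Hits u v → (S u ≼ S v × S v ≼ E u) ⊎ (¬ (S u ≼ S v) × S+1 v ≼ E u)
    hits⇒0or1 {u} {v} (+ 0 , lo , hi) = inj₁
      (subst (λ i → S u ≼ (start (arc v) , i)) (ℤ.+-identityʳ _) lo ,
       subst (λ i → (start (arc v) , i) ≼ E u) (ℤ.+-identityʳ _) hi)
    hits⇒0or1 {u} {v} (+ 1 , lo , hi) with S≼S? u v
    -- A starting point not before `S u` is then hit without translation as well.
    ... | yes u≼v = inj₁ (u≼v , ≼-trans (S≼S+1 v v) hi)
    ... | no u⋠v = inj₂ (u⋠v , hi)
    hits⇒0or1 {u} {v} (+ suc (suc k) , lo , hi) = ⊥-elim (S+1⋠S u v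
      (≼-trans (≼-raise (offset v ℤ.+ 1ℤ) k)
        (≼-shift (≼-trans hi (E≼S+1 u)) (ring (offset u) (offset v) (+ k)))))
      where
      ring : ∀ i j k → (j ℤ.+ (1ℤ ℤ.+ (1ℤ ℤ.+ k))) ℤ.+ i ≡ (k ℤ.+ (j ℤ.+ 1ℤ)) ℤ.+ (i ℤ.+ 1ℤ)
      ring = solve-∀
    hits⇒0or1 {u} {v} (-[1+ k ] , lo , hi) = ⊥-elim (S+1⋠S v u
      (≼-trans (≼-raise (offset u ℤ.+ 1ℤ) k) (≼-shift lo (ring (offset u) (offset v) (+ k)))))
      where
      ring : ∀ i j k → i ℤ.+ j ≡ (k ℤ.+ (i ℤ.+ 1ℤ)) ℤ.+ (j ℤ.+ ℤ.- (1ℤ ℤ.+ k))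
      ring = solve-∀

    -- An arc containing a lift of `S v` contains all lifted starting points from its own start up
    -- to there. A translate by 1 means that it passes the cut.
    hits⇒run : ∀ {u v} → u ≢ v → Hits u v →
      Run G ⊑-isDecTotalOrder u v ⊎ Run G ⊑-isDecTotalOrder v u
    hits⇒run {u} {v} u≢v h with hits⇒0or1 h
    ... | inj₁ (u≼v , v≼Eu) with ⊑-total u v
    ...   | inj₁ u⊑v = inj₁ (inj₁ (u⊑v , λ {w} w⋢u w⊑v →
            hits₀⇒adj (λ { refl → w⋢u (≼-refl , λ _ → Fin.≤-refl) })
              (proj₁ (⋢⇒⊒ w⋢u)) (≼-trans (proj₁ w⊑v) v≼Eu)))
    -- The starting points coincide and the index puts `v` first, so the run starts at `v`.
    ...   | inj₂ v⊑u = inj₂ (inj₁ (v⊑u , λ {w} w⋢v w⊑u →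
            hits₀⇒adj (λ { refl → w⋢v (≼-refl , λ _ → Fin.≤-refl) })
              (proj₁ (⋢⇒⊒ w⋢v)) (≼-trans (proj₁ w⊑u) (≼-trans u≼v (S≼E v)))))
    hits⇒run {u} {v} u≢v h | inj₂ (u⋠v , v+1≼Eu) =
      inj₁ (inj₂ ((≰⇒≽ u⋠v , ⊥-elim ∘ u⋠v) , λ
        { {w} (inj₁ w⋢u) → hits₀⇒adj (λ { refl → w⋢u (≼-refl , λ _ → Fin.≤-refl) })
            (proj₁ (⋢⇒⊒ w⋢u)) (≼-trans (S≼S+1 w v) v+1≼Eu)
        ; {w} (inj₂ w⊑v) → hits₁⇒adj (λ { refl → u⋠v (proj₁ w⊑v) })
            (≼-trans (≼-shift (proj₁ w⊑v) (ring (offset w) (offset v))) v+1≼Eu) }))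
      where
      ring : ∀ i j → i ℤ.+ (j ℤ.+ 1ℤ) ≡ (i ℤ.+ 1ℤ) ℤ.+ j
      ring = solve-∀

circularArc⇒¬¬semiorders : (G : Graph n) → IsCircularArc G →
                           ¬ ¬ HasSemiorders G (suc (2 * maxDegree G))
circularArc⇒¬¬semiorders G (arc , rep) none =
  ¬¬-∀ (λ v → ¬¬-reduce (Arc.start (arc v))) λ red →
  ¬¬-∀ (λ u → ¬¬-∀ λ v → ¬¬-excluded-middle) λ S≼S? →
  ¬¬-∀ (λ u → ¬¬-∀ λ v → ¬¬-hits red u v) λ hits →
  none (runs⇒semiorders G (⊑-isDecTotalOrder G arc rep red S≼S?) λ {u} {v} a →
    let u≢v = λ u≡v → Graph.irreflexive G u≡v a in
    Sum.[ hits⇒run G arc rep red S≼S? u≢v , Sum.swap ∘ hits⇒run G arc rep red S≼S? (≢-sym u≢v) ]′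
      (hits u v a))
  where
  ¬¬-hits : ∀ red u v → ¬ ¬ (Adj G u v → Hits G arc rep red u v ⊎ Hits G arc rep red v u)
  ¬¬-hits red u v k with adj? G u v
  ... | yes a = adj⇒¬¬hits G arc rep red a λ h → k λ _ → h
  ... | no ¬a = k (⊥-elim ∘ ¬a)

corollary1 : ∀ {n : ℕ} (G : Graph n) → IsCircularArc G →
    ∃[ c ] IsCubicity G c × c ≤ 2 * maxDegree G + 1
corollary1 G arcs = subst (λ k → ∃[ c ] IsCubicity G c × c ≤ k) (ℕ.+-comm 1 (2 * maxDegree G))
  (cubicity-≤ G (semiorders⇒cubes G
    -- The double negation is removed here, where existence is decided by a finite search, before
    -- any cubes are built.
    (decidable-stable (hasSemiorders? G _) (circularArc⇒¬¬semiorders G arcs))))
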